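{- Let $D$ be a finite digraph on $n$ vertices, let $S$ be the set of sources of $D$ (vertices of indegree $0$), and let $N_D^+(S)=\bigl(\bigcup_{x\in S}N_D^+(x)\bigr)\setminus S$ and $N_D^+[S]=N_D^+(S)\cup S$. Suppose that $V(D)\setminus N_D^+[S]$ has a partition $V_1\cup V_2$ such that the induced subdigraph $D[V_i]$ is kernel-perfect for each $i=1,2$. Then $D$ has a quasi-kernel of size at most $\frac{n+|S|-|N_D^+(S)|}{2}$.
   Context: Digraphs are finite, have no loops, and may contain antiparallel arcs. For a vertex $x$, $N_D^+(x)=\{y: xy\in A(D)\}$. A set $K\subseteq V(D)$ is independent if no arc of $D$ joins two vertices of $K$. The distance ${\rm dist}_D(u,v)$ is the length of a shortest directed path from $u$ to $v$, and ${\rm dist}_D(K,v)=\min_{x\in K}{\rm dist}_D(x,v)$. A kernel of $D$ is an independent set $K$ with ${\rm dist}_D(K,v)=1$ for every $v\in V(D)\setminus K$. A quasi-kernel of $D$ is an independent set $K$ with ${\rm dist}_D(K,v)\le 2$ for every $v\in V(D)\setminus K$. A digraph is kernel-perfect if every induced subdigraph of it has a kernel. -}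

module Defs where

open import Data.Nat using (ℕ; suc; _+_; _*_; _≤_)
open import Data.Fin using (Fin)
open import Data.Fin.Subset using (Subset; _∈_; _∉_; _⊆_; ∣_∣)
open import Data.Bool using (Bool; true; false; T)
open import Data.Product using (Σ; ∃; _×_; _,_)
open import Data.Empty using (⊥)
open import Data.Sum using (_⊎_)
open import Relation.Nullary using (¬_)
open import Relation.Binary.PropositionalEquality using (_≡_)

record Digraph (n : ℕ) : Set where
  field
    arc    : Fin n → Fin n → Bool
    noLoop : ∀ x → arc x x ≡ false

open Digraph public

Arc : ∀ {n} → Digraph n → Fin n → Fin n → Set
Arc D x y = T (arc D x y)

data Walk {n} (D : Digraph n) : ℕ → Fin n → Fin n → Set where
  here : ∀ {u} → Walk D 0 u u
  step : ∀ {k u w v} → Arc D u w → Walk D k w v → Walk D (suc k) u v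

-- dist_D(u,v) ≤ k  (a shortest directed path has length ≤ k iff some walk of length ≤ k exists)
DistLe : ∀ {n} → Digraph n → Fin n → Fin n → ℕ → Set
DistLe D u v k = Σ ℕ λ j → j ≤ k × Walk D j u v

DistSetLe : ∀ {n} → Digraph n → Subset n → Fin n → ℕ → Set
DistSetLe D K v k = Σ _ λ x → x ∈ K × DistLe D x v k

Independent : ∀ {n} → Digraph n → Subset n → Set
Independent D K = ∀ x y → x ∈ K → y ∈ K → ¬ Arc D x y

IsQuasiKernel : ∀ {n} → Digraph n → Subset n → Set
IsQuasiKernel D K = Independent D K × (∀ v → v ∉ K → DistSetLe D K v 2)

-- Kernel of the induced subdigraph D[U]: K ⊆ U independent, and every
-- v ∈ U \ K has an in-neighbour in K (dist = 1 inside D[U]; arcs of D[U] are arcs of D).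
IsKernelOfInduced : ∀ {n} → Digraph n → Subset n → Subset n → Set
IsKernelOfInduced D U K =
  K ⊆ U × Independent D K ×
  (∀ v → v ∈ U → v ∉ K → Σ _ λ x → x ∈ K × Arc D x v)

KernelPerfectOn : ∀ {n} → Digraph n → Subset n → Set
KernelPerfectOn D W = ∀ U → U ⊆ W → Σ (Subset _) λ K → IsKernelOfInduced D U K

IsSource : ∀ {n} → Digraph n → Fin n → Set
IsSource D x = ∀ y → ¬ Arc D y x

IsSourceSet : ∀ {n} → Digraph n → Subset n → Set
IsSourceSet D S = ∀ x → (x ∈ S → IsSource D x) × (IsSource D x → x ∈ S)

IsOutNbhdOf : ∀ {n} → Digraph n → Subset n → Subset n → Set
IsOutNbhdOf D S N = ∀ v →
  (v ∈ N → v ∉ S × (Σ _ λ x → x ∈ S × Arc D x v)) ×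
  (v ∉ S → (Σ _ λ x → x ∈ S × Arc D x v) → v ∈ N)

IsPartitionOfRest : ∀ {n} → Subset n → Subset n → Subset n → Subset n → Set
IsPartitionOfRest S N V₁ V₂ = ∀ v →
  ((v ∉ S × v ∉ N) → (v ∈ V₁ × v ∉ V₂) ⊎ (v ∈ V₂ × v ∉ V₁)) ×
  (v ∈ V₁ → v ∉ S × v ∉ N) × (v ∈ V₂ → v ∉ S × v ∉ N)

{-# OPTIONS --safe #-}
module Submission where

open import Defs
open import Data.Bool using (true; false; T?)
open import Data.Fin using (Fin)
open import Data.Fin.Properties using (any?)
open import Data.Fin.Subset using (Subset; ∣_∣; _∈_; _∉_; _⊆_; _∪_; _∩_; _─_; Empty)
open import Data.Fin.Subset.Properties
  using (_∈?_; ∣p∣≤n; ∣⊥∣≡0; Empty-unique; p⊆q⇒∣p∣≤∣q∣; p⊆p∪q; q⊆p∪q; x∈p∪q⁻;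
         x∈p∩q⁺; x∈p∩q⁻; p∩q⊆p; p∩q⊆q; x∈p∧x∉q⇒x∈p─q; p─q⊆p)
open import Data.Nat using (ℕ; suc; _+_; _*_; _≤_; z≤n; s≤s)
open import Data.Nat.Properties
  using (+-suc; +-identityʳ; +-mono-≤; +-monoˡ-≤; +-monoʳ-≤; ≤-total; module ≤-Reasoning)
open import Data.Nat.Tactic.RingSolver using (solve-∀)
open import Data.Product using (Σ; ∃; _×_; _,_; proj₁; proj₂)
open import Data.Sum using (_⊎_; inj₁; inj₂; map₂)
open import Data.Vec using ([]; _∷_; there; tabulate)
open import Data.Vec.Properties using (lookup⇒[]=; []=⇒lookup; lookup∘tabulate)
open import Function using (_∘_)
open import Relation.Binary.PropositionalEquality
  using (_≡_; refl; sym; trans; cong; subst)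
open import Relation.Nullary using (¬_; Dec; yes; no; does; proof; contradiction; _×-dec_; invert)
open import Relation.Nullary.Decidable using (dec-true)
open import Relation.Nullary.Reflects using (Reflects)

-- Sources belong to every quasi-kernel and take care of N, so only R = V₁ ∪ V₂
-- matters.  The combination A ▷ B = A ∪ (B ∖ N⁺(A)) of two kernel-perfect sets
-- is kernel-perfect, because it has no arc from A to the rest, and it dominates
-- A ∪ B.  Split R into P = V₁ ▷ V₂ and P′ = V₂ ∩ N⁺(V₁), so that P dominates P′.
-- Let K be a kernel of P′ ▷ P, let W = P ∖ K, and let K′ be a kernel of W ▷ P′.
-- A vertex of P ∩ K has no in-neighbour in K or P′, so it is dominated from W or
-- from N; hence both K and K′ reach R within distance 2.  A vertex of P′ ∖ N⁺(W)
-- has its in-neighbour in P inside K, hence lies outside K; so K and K′ are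
-- disjoint, and the smaller one has at most |R| / 2 vertices.

-- Cardinalities of finite subsets.

∣p∪q∣+∣p∩q∣≡∣p∣+∣q∣ : ∀ {n} (p q : Subset n) → ∣ p ∪ q ∣ + ∣ p ∩ q ∣ ≡ ∣ p ∣ + ∣ q ∣
∣p∪q∣+∣p∩q∣≡∣p∣+∣q∣ []          []          = refl
∣p∪q∣+∣p∩q∣≡∣p∣+∣q∣ (false ∷ p) (false ∷ q) = ∣p∪q∣+∣p∩q∣≡∣p∣+∣q∣ p q
∣p∪q∣+∣p∩q∣≡∣p∣+∣q∣ (true  ∷ p) (false ∷ q) = cong suc (∣p∪q∣+∣p∩q∣≡∣p∣+∣q∣ p q)
∣p∪q∣+∣p∩q∣≡∣p∣+∣q∣ (false ∷ p) (true  ∷ q) =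
  trans (cong suc (∣p∪q∣+∣p∩q∣≡∣p∣+∣q∣ p q)) (sym (+-suc (∣ p ∣) (∣ q ∣)))
∣p∪q∣+∣p∩q∣≡∣p∣+∣q∣ (true  ∷ p) (true  ∷ q) = cong suc (trans (+-suc (∣ p ∪ q ∣) (∣ p ∩ q ∣))
  (trans (cong suc (∣p∪q∣+∣p∩q∣≡∣p∣+∣q∣ p q)) (sym (+-suc (∣ p ∣) (∣ q ∣)))))

disjoint⇒∣p∣+∣q∣≤n : ∀ {n} (p q : Subset n) → (∀ {x} → x ∈ p → x ∉ q) → ∣ p ∣ + ∣ q ∣ ≤ n
disjoint⇒∣p∣+∣q∣≤n {n} p q p∌q = begin
  ∣ p ∣ + ∣ q ∣           ≡⟨ ∣p∪q∣+∣p∩q∣≡∣p∣+∣q∣ p q ⟨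
  ∣ p ∪ q ∣ + ∣ p ∩ q ∣   ≡⟨ cong (∣ p ∪ q ∣ +_) ∣p∩q∣≡0 ⟩
  ∣ p ∪ q ∣ + 0           ≡⟨ +-identityʳ _ ⟩
  ∣ p ∪ q ∣               ≤⟨ ∣p∣≤n (p ∪ q) ⟩
  n                       ∎
  where
  open ≤-Reasoning
  p∩q-empty : Empty (p ∩ q)
  p∩q-empty (x , x∈p∩q) with x∈p∩q⁻ p q x∈p∩q
  ... | x∈p , x∈q = p∌q x∈p x∈q
  ∣p∩q∣≡0 : ∣ p ∩ q ∣ ≡ 0
  ∣p∩q∣≡0 = trans (cong ∣_∣ (Empty-unique p∩q-empty)) (∣⊥∣≡0 n)

-- Doubling the smaller set costs at most `∣ p ∣ + ∣ q ∣`, which splits into a union disjoint from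
-- `r` and an intersection inside `s`. It serves for `p`, `q` the two candidate quasi-kernels, `r`
-- the set `N` and `s` the sources.
smaller-bound : ∀ {n} (p q r s : Subset n) → (∀ {x} → x ∈ p → x ∈ q → x ∈ s) →
  (∀ {x} → x ∈ p → x ∉ r) → (∀ {x} → x ∈ q → x ∉ r) →
  ∣ p ∣ ≤ ∣ q ∣ → 2 * ∣ p ∣ + ∣ r ∣ ≤ n + ∣ s ∣
smaller-bound {n} p q r s common p∌r q∌r ∣p∣≤∣q∣ = begin
  2 * ∣ p ∣ + ∣ r ∣               ≡⟨ cong (λ z → ∣ p ∣ + z + ∣ r ∣) (+-identityʳ ∣ p ∣) ⟩
  ∣ p ∣ + ∣ p ∣ + ∣ r ∣           ≤⟨ +-monoˡ-≤ ∣ r ∣ (+-monoʳ-≤ ∣ p ∣ ∣p∣≤∣q∣) ⟩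
  ∣ p ∣ + ∣ q ∣ + ∣ r ∣           ≡⟨ cong (_+ ∣ r ∣) (∣p∪q∣+∣p∩q∣≡∣p∣+∣q∣ p q) ⟨
  ∣ p ∪ q ∣ + ∣ p ∩ q ∣ + ∣ r ∣   ≡⟨ swap (∣ p ∪ q ∣) (∣ p ∩ q ∣) (∣ r ∣) ⟩
  ∣ p ∪ q ∣ + ∣ r ∣ + ∣ p ∩ q ∣   ≤⟨ +-mono-≤ (disjoint⇒∣p∣+∣q∣≤n (p ∪ q) r p∪q∌r) (p⊆q⇒∣p∣≤∣q∣ p∩q⊆s) ⟩
  n + ∣ s ∣                       ∎
  where
  open ≤-Reasoning
  swap : ∀ a b c → a + b + c ≡ a + c + b
  swap = solve-∀
  p∩q⊆s : p ∩ q ⊆ s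
  p∩q⊆s x∈p∩q = common (p∩q⊆p p q x∈p∩q) (p∩q⊆q p q x∈p∩q)
  p∪q∌r : ∀ {x} → x ∈ p ∪ q → x ∉ r
  p∪q∌r x∈p∪q with x∈p∪q⁻ p q x∈p∪q
  ... | inj₁ x∈p = p∌r x∈p
  ... | inj₂ x∈q = q∌r x∈q

x∈p─q⇒x∉q : ∀ {n} {x : Fin n} (p q : Subset n) → x ∈ p ─ q → x ∉ q
-- The case of two `here` proofs is impossible: one for `q` makes its head `true`, and then the head
-- of `p ─ q` computes to `false`.
x∈p─q⇒x∉q (_ ∷ p) (_ ∷ q) (there x∈p─q) (there x∈q) = x∈p─q⇒x∉q p q x∈p─q x∈q

-- Domination and the combination of kernel-perfect sets.

module _ {n} (D : Digraph n) where

  DominatedBy : Subset n → Fin n → Set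
  DominatedBy U v = ∃ λ u → u ∈ U × Arc D u v

  dominated? : ∀ U v → Dec (DominatedBy U v)
  dominated? U v = any? λ u → (u ∈? U) ×-dec T? (arc D u v)

  -- Unlike the set `N` of the theorem, this out-neighbourhood may meet `U` itself.
  N⁺ : Subset n → Subset n
  N⁺ U = tabulate λ v → does (dominated? U v)

  ∈N⁺⁺ : ∀ U {v} → DominatedBy U v → v ∈ N⁺ U
  ∈N⁺⁺ U {v} dom = lookup⇒[]= v _ (trans (lookup∘tabulate _ v) (dec-true (dominated? U v) dom))

  ∈N⁺⁻ : ∀ U {v} → v ∈ N⁺ U → DominatedBy U v
  -- Membership makes the tabulated Boolean `true`; transported along that equation, the `Reflects`
  -- proof of the decision yields the witness.
  ∈N⁺⁻ U {v} v∈ = invert (subst (Reflects _)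
    (trans (sym (lookup∘tabulate _ v)) ([]=⇒lookup v∈)) (proof (dominated? U v)))

  KernelPerfectOn-⊆ : ∀ {A B} → A ⊆ B → KernelPerfectOn D B → KernelPerfectOn D A
  KernelPerfectOn-⊆ A⊆B kp U U⊆A = kp U (A⊆B ∘ U⊆A)

  infixr 6 _▷_
  _▷_ : Subset n → Subset n → Subset n
  A ▷ B = A ∪ (B ─ N⁺ A)

  ▷-dominates : ∀ A B {v} → v ∈ B → v ∈ A ▷ B ⊎ DominatedBy (A ▷ B) v
  ▷-dominates A B {v} v∈B with v ∈? N⁺ A
  ... | no v∉N⁺A = inj₁ (q⊆p∪q A _ (x∈p∧x∉q⇒x∈p─q v∈B v∉N⁺A))
  ... | yes v∈N⁺A with ∈N⁺⁻ A v∈N⁺A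
  ...   | u , u∈A , u→v = inj₂ (u , p⊆p∪q _ u∈A , u→v)

  -- No arc runs from `A` to `B ─ N⁺ A`, so a kernel `KB` of the part of `U` there can be fixed
  -- first. The vertices of `U ∩ A` that `KB` dominates are discarded, and a kernel `KA` of the
  -- remainder completes it.
  ▷-kernelPerfect : ∀ A B → KernelPerfectOn D A → KernelPerfectOn D B → KernelPerfectOn D (A ▷ B)
  ▷-kernelPerfect A B kpA kpB U U⊆A▷B = KA ∪ KB , K⊆U , indep , dom
    where
    UB = U ∩ (B ─ N⁺ A)
    kerB = kpB UB (p─q⊆p B _ ∘ p∩q⊆q U _)
    KB = proj₁ kerB
    KB⊆UB = proj₁ (proj₂ kerB)
    UA = (U ∩ A) ─ N⁺ KB
    kerA = kpA UA (p∩q⊆q U A ∘ p─q⊆p (U ∩ A) _)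
    KA = proj₁ kerA
    KA⊆UA = proj₁ (proj₂ kerA)

    K⊆U : KA ∪ KB ⊆ U
    K⊆U x∈K with x∈p∪q⁻ KA KB x∈K
    ... | inj₁ x∈KA = p∩q⊆p U A (p─q⊆p (U ∩ A) _ (KA⊆UA x∈KA))
    ... | inj₂ x∈KB = p∩q⊆p U _ (KB⊆UB x∈KB)

    indep : Independent D (KA ∪ KB)
    indep x y x∈K y∈K x→y with x∈p∪q⁻ KA KB x∈K | x∈p∪q⁻ KA KB y∈K
    ... | inj₁ x∈KA | inj₁ y∈KA = proj₁ (proj₂ (proj₂ kerA)) x y x∈KA y∈KA x→y
    ... | inj₂ x∈KB | inj₂ y∈KB = proj₁ (proj₂ (proj₂ kerB)) x y x∈KB y∈KB x→y
    -- Arcs from `KB` to `KA` are blocked by the removal of `N⁺ KB` from `UA`, arcs from `KA` to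
    -- `KB` by the removal of `N⁺ A` from `B`.
    ... | inj₂ x∈KB | inj₁ y∈KA =
      x∈p─q⇒x∉q (U ∩ A) _ (KA⊆UA y∈KA) (∈N⁺⁺ KB (x , x∈KB , x→y))
    ... | inj₁ x∈KA | inj₂ y∈KB =
      x∈p─q⇒x∉q B _ (p∩q⊆q U _ (KB⊆UB y∈KB))
        (∈N⁺⁺ A (x , p∩q⊆q U A (p─q⊆p (U ∩ A) _ (KA⊆UA x∈KA)) , x→y))

    dom : ∀ v → v ∈ U → v ∉ KA ∪ KB → DominatedBy (KA ∪ KB) v
    dom v v∈U v∉K with x∈p∪q⁻ A _ (U⊆A▷B v∈U)
    ... | inj₂ v∈B─ with proj₂ (proj₂ (proj₂ kerB)) v (x∈p∩q⁺ (v∈U , v∈B─)) (v∉K ∘ q⊆p∪q KA KB)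
    ...   | u , u∈KB , u→v = u , q⊆p∪q KA KB u∈KB , u→v
    dom v v∈U v∉K | inj₁ v∈A with v ∈? N⁺ KB
    ... | yes v∈N⁺KB with ∈N⁺⁻ KB v∈N⁺KB
    ...   | u , u∈KB , u→v = u , q⊆p∪q KA KB u∈KB , u→v
    dom v v∈U v∉K | inj₁ v∈A | no v∉N⁺KB
      with proj₂ (proj₂ (proj₂ kerA)) v (x∈p∧x∉q⇒x∈p─q (x∈p∩q⁺ (v∈U , v∈A)) v∉N⁺KB) (v∉K ∘ p⊆p∪q KB)
    ... | u , u∈KA , u→v = u , p⊆p∪q KB u∈KA , u→v

  -- Quasi-kernels made of the sources and a kernel.

  kernel∪sources-quasiKernel : ∀ {S N U K} → IsSourceSet D S → IsOutNbhdOf D S N →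
    (∀ {v} → v ∈ U → v ∉ S × v ∉ N) →
    (∀ {v} → v ∉ S → v ∉ N → v ∈ U ⊎ DominatedBy U v ⊎ DominatedBy N v) →
    IsKernelOfInduced D U K → IsQuasiKernel D (S ∪ K)
  kernel∪sources-quasiKernel {S} {N} {U} {K} srcS outN U⊆R reach (K⊆U , indepK , domK) = indep , cover
    where
    indep : Independent D (S ∪ K)
    indep x y x∈ y∈ x→y with x∈p∪q⁻ S K y∈
    ... | inj₁ y∈S = proj₁ (srcS y) y∈S x x→y
    ... | inj₂ y∈K with x∈p∪q⁻ S K x∈
    ...   | inj₂ x∈K = indepK x y x∈K y∈K x→y
    -- An arc from a source would put `y` into `N`, which `U` avoids.
    ...   | inj₁ x∈S with U⊆R (K⊆U y∈K)
    ...     | y∉S , y∉N = y∉N (proj₂ (outN y) y∉S (x , x∈S , x→y))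

    S⊆ : S ⊆ S ∪ K
    S⊆ = p⊆p∪q K

    cover : ∀ v → v ∉ S ∪ K → DistSetLe D (S ∪ K) v 2
    cover v v∉ with v ∈? N
    ... | yes v∈N with proj₂ (proj₁ (outN v) v∈N)
    ...   | s , s∈S , s→v = s , S⊆ s∈S , 1 , s≤s z≤n , step s→v here
    cover v v∉ | no v∉N with reach (v∉ ∘ S⊆) v∉N
    ... | inj₁ v∈U with domK v v∈U (v∉ ∘ q⊆p∪q S K)
    ...   | x , x∈K , x→v = x , q⊆p∪q S K x∈K , 1 , s≤s z≤n , step x→v here
    -- The set `N` is one step from the sources, so whatever it dominates is within two.
    cover v v∉ | no v∉N | inj₂ (inj₂ (w , w∈N , w→v)) with proj₂ (proj₁ (outN w) w∈N)
    ... | s , s∈S , s→w = s , S⊆ s∈S , 2 , s≤s (s≤s z≤n) , step s→w (step w→v here)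
    cover v v∉ | no v∉N | inj₂ (inj₁ (u , u∈U , u→v)) with u ∈? K
    ... | yes u∈K = u , q⊆p∪q S K u∈K , 1 , s≤s z≤n , step u→v here
    ... | no u∉K with domK u u∈U u∉K
    ...   | x , x∈K , x→u = x , q⊆p∪q S K x∈K , 2 , s≤s (s≤s z≤n) , step x→u (step u→v here)

  -- Repartition of the rest and a pair of disjoint kernels.

  ▷-partition : ∀ {S N V₁ V₂} → IsPartitionOfRest S N V₁ V₂ →
    IsPartitionOfRest S N (V₁ ▷ V₂) (V₂ ∩ N⁺ V₁)
  ▷-partition {S} {N} {V₁} {V₂} part v = side , V₁▷V₂-rest , proj₂ (proj₂ (part v)) ∘ p∩q⊆p V₂ _
    where
    V₁▷V₂-rest : v ∈ V₁ ▷ V₂ → v ∉ S × v ∉ N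
    V₁▷V₂-rest v∈ with x∈p∪q⁻ V₁ _ v∈
    ... | inj₁ v∈V₁ = proj₁ (proj₂ (part v)) v∈V₁
    ... | inj₂ v∈V₂─ = proj₂ (proj₂ (part v)) (p─q⊆p V₂ _ v∈V₂─)

    side : v ∉ S × v ∉ N →
      (v ∈ V₁ ▷ V₂ × v ∉ V₂ ∩ N⁺ V₁) ⊎ (v ∈ V₂ ∩ N⁺ V₁ × v ∉ V₁ ▷ V₂)
    side v∉ with proj₁ (part v) v∉
    ... | inj₁ (v∈V₁ , v∉V₂) = inj₁ (p⊆p∪q _ v∈V₁ , v∉V₂ ∘ p∩q⊆p V₂ _)
    ... | inj₂ (v∈V₂ , v∉V₁) with v ∈? N⁺ V₁
    -- Only undominated vertices of `V₂` change class, so each vertex left in the second class has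
    -- an in-neighbour in the first.
    ...   | no v∉N⁺ = inj₁ (q⊆p∪q V₁ _ (x∈p∧x∉q⇒x∈p─q v∈V₂ v∉N⁺) , v∉N⁺ ∘ p∩q⊆q V₂ _)
    ...   | yes v∈N⁺ = inj₂ (x∈p∩q⁺ (v∈V₂ , v∈N⁺) , v∉V₁▷V₂)
      where
      v∉V₁▷V₂ : v ∉ V₁ ▷ V₂
      v∉V₁▷V₂ v∈ with x∈p∪q⁻ V₁ _ v∈
      ... | inj₁ v∈V₁ = v∉V₁ v∈V₁
      ... | inj₂ v∈V₂─ = x∈p─q⇒x∉q V₂ _ v∈V₂─ v∈N⁺

  inNeighbour : ∀ {S v} → IsSourceSet D S → v ∉ S → ∃ λ u → Arc D u v
  inNeighbour {v = v} srcS v∉S with any? (λ u → T? (arc D u v))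
  ... | yes found = found
  ... | no none = contradiction (proj₂ (srcS v) λ u u→v → none (u , u→v)) v∉S

  -- The kernel `K′` is built around `K`: deleting `K` from `P` keeps the two apart inside `P`, and
  -- `P′ ⊆ N⁺ P` keeps them apart inside `P′`.
  small-quasiKernel : ∀ {S N P P′ K K′} → IsSourceSet D S → IsOutNbhdOf D S N →
    IsPartitionOfRest S N P P′ → P′ ⊆ N⁺ P →
    IsKernelOfInduced D (P′ ▷ P) K → IsKernelOfInduced D ((P ─ K) ▷ P′) K′ →
    Σ (Subset n) λ Q → IsQuasiKernel D Q × 2 * ∣ Q ∣ + ∣ N ∣ ≤ n + ∣ S ∣
  small-quasiKernel {S} {N} {P} {P′} {K} {K′} srcS outN part P′⊆N⁺P
    ker@(K⊆U , K-indep , _) ker′@(K′⊆U′ , _) = choose (≤-total ∣ Q ∣ ∣ Q′ ∣)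
    where
    W U U′ Q Q′ : Subset n
    W = P ─ K
    U = P′ ▷ P
    U′ = W ▷ P′
    Q = S ∪ K
    Q′ = S ∪ K′

    P-rest : ∀ {v} → v ∈ P → v ∉ S × v ∉ N
    P-rest {v} = proj₁ (proj₂ (part v))

    P′-rest : ∀ {v} → v ∈ P′ → v ∉ S × v ∉ N
    P′-rest {v} = proj₂ (proj₂ (part v))

    U-rest : ∀ {v} → v ∈ U → v ∉ S × v ∉ N
    U-rest v∈ with x∈p∪q⁻ P′ _ v∈
    ... | inj₁ v∈P′ = P′-rest v∈P′
    ... | inj₂ v∈P─ = P-rest (p─q⊆p P _ v∈P─)

    U′-rest : ∀ {v} → v ∈ U′ → v ∉ S × v ∉ N
    U′-rest v∈ with x∈p∪q⁻ W _ v∈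
    ... | inj₁ v∈W = P-rest (p─q⊆p P K v∈W)
    ... | inj₂ v∈P′─ = P′-rest (p─q⊆p P′ _ v∈P′─)

    disjoint : ∀ {v} → v ∈ P → v ∉ P′
    disjoint {v} v∈P v∈P′ with proj₁ (part v) (P-rest v∈P)
    ... | inj₁ (_ , v∉P′) = v∉P′ v∈P′
    ... | inj₂ (_ , v∉P) = v∉P v∈P

    -- Since `P` and `P′` are disjoint, such a `v` entered `P′ ▷ P` by surviving the removal of
    -- `N⁺ P′`.
    K∩P-undominatedBy-P′ : ∀ {u v} → v ∈ K → v ∈ P → u ∈ P′ → ¬ Arc D u v
    K∩P-undominatedBy-P′ {u} v∈K v∈P u∈P′ u→v with x∈p∪q⁻ P′ _ (K⊆U v∈K)
    ... | inj₂ v∈P─ = x∈p─q⇒x∉q P _ v∈P─ (∈N⁺⁺ P′ (u , u∈P′ , u→v))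
    ... | inj₁ v∈P′ = disjoint v∈P v∈P′

    reach : ∀ {v} → v ∉ S → v ∉ N → v ∈ U ⊎ DominatedBy U v ⊎ DominatedBy N v
    reach {v} v∉S v∉N with proj₁ (part v) (v∉S , v∉N)
    ... | inj₂ (v∈P′ , _) = inj₁ (p⊆p∪q _ v∈P′)
    ... | inj₁ (v∈P , _) = map₂ inj₁ (▷-dominates P′ P v∈P)

    reach′ : ∀ {v} → v ∉ S → v ∉ N → v ∈ U′ ⊎ DominatedBy U′ v ⊎ DominatedBy N v
    reach′ {v} v∉S v∉N with proj₁ (part v) (v∉S , v∉N)
    ... | inj₂ (v∈P′ , _) = map₂ inj₁ (▷-dominates W P′ v∈P′)
    ... | inj₁ (v∈P , _) with v ∈? K
    ...   | no v∉K = inj₁ (p⊆p∪q _ (x∈p∧x∉q⇒x∈p─q v∈P v∉K))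
    -- Not being a source, `v` has an in-neighbour `u`. It is no source, as `v` is outside `N`; it
    -- is not in `P′`; and if it is in `P`, independence of `K` puts it in `W`.
    ...   | yes v∈K with inNeighbour srcS v∉S
    ...     | u , u→v with u ∈? S | u ∈? N
    ...       | yes u∈S | _ = contradiction (proj₂ (outN v) v∉S (u , u∈S , u→v)) v∉N
    ...       | no _ | yes u∈N = inj₂ (inj₂ (u , u∈N , u→v))
    ...       | no u∉S | no u∉N with proj₁ (part u) (u∉S , u∉N)
    ...         | inj₂ (u∈P′ , _) = contradiction u→v (K∩P-undominatedBy-P′ v∈K v∈P u∈P′)
    ...         | inj₁ (u∈P , _) = inj₂ (inj₁ (u , p⊆p∪q _ (x∈p∧x∉q⇒x∈p─q u∈P u∉K) , u→v))
      where
      u∉K : u ∉ K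
      u∉K u∈K = K-indep u v u∈K v∈K u→v

    -- As `W` omits `K`, a common vertex would lie in `P′ ─ N⁺ W`. Its in-neighbour in `P` is then
    -- either in `K`, against independence, or in `W`, against that removal.
    K-K′-disjoint : ∀ {v} → v ∈ K → v ∉ K′
    K-K′-disjoint {v} v∈K v∈K′ with x∈p∪q⁻ W _ (K′⊆U′ v∈K′)
    ... | inj₁ v∈W = x∈p─q⇒x∉q P K v∈W v∈K
    ... | inj₂ v∈P′─ with ∈N⁺⁻ P (P′⊆N⁺P (p─q⊆p P′ _ v∈P′─))
    ...   | u , u∈P , u→v with u ∈? K
    ...     | yes u∈K = K-indep u v u∈K v∈K u→v
    ...     | no u∉K = x∈p─q⇒x∉q P′ _ v∈P′─ (∈N⁺⁺ W (u , x∈p∧x∉q⇒x∈p─q u∈P u∉K , u→v))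

    Q-quasiKernel : IsQuasiKernel D Q
    Q-quasiKernel = kernel∪sources-quasiKernel srcS outN U-rest reach ker

    Q′-quasiKernel : IsQuasiKernel D Q′
    Q′-quasiKernel = kernel∪sources-quasiKernel srcS outN U′-rest reach′ ker′

    common⊆S : ∀ {x} → x ∈ Q → x ∈ Q′ → x ∈ S
    common⊆S x∈Q x∈Q′ with x∈p∪q⁻ S K x∈Q | x∈p∪q⁻ S K′ x∈Q′
    ... | inj₁ x∈S | _ = x∈S
    ... | inj₂ _ | inj₁ x∈S = x∈S
    ... | inj₂ x∈K | inj₂ x∈K′ = contradiction x∈K′ (K-K′-disjoint x∈K)

    avoids-N : ∀ L {x} → (x ∈ L → x ∉ S × x ∉ N) → x ∈ S ∪ L → x ∉ N
    avoids-N L {x} L-rest x∈ x∈N with x∈p∪q⁻ S L x∈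
    ... | inj₁ x∈S = proj₁ (proj₁ (outN x) x∈N) x∈S
    ... | inj₂ x∈L = proj₂ (L-rest x∈L) x∈N

    Q-avoids-N : ∀ {x} → x ∈ Q → x ∉ N
    Q-avoids-N = avoids-N K (U-rest ∘ K⊆U)

    Q′-avoids-N : ∀ {x} → x ∈ Q′ → x ∉ N
    Q′-avoids-N = avoids-N K′ (U′-rest ∘ K′⊆U′)

    choose : ∣ Q ∣ ≤ ∣ Q′ ∣ ⊎ ∣ Q′ ∣ ≤ ∣ Q ∣ →
      Σ (Subset n) λ X → IsQuasiKernel D X × 2 * ∣ X ∣ + ∣ N ∣ ≤ n + ∣ S ∣
    choose (inj₁ Q≤Q′) = Q , Q-quasiKernel ,
      smaller-bound Q Q′ N S common⊆S Q-avoids-N Q′-avoids-N Q≤Q′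
    choose (inj₂ Q′≤Q) = Q′ , Q′-quasiKernel ,
      smaller-bound Q′ Q N S (λ x∈Q′ x∈Q → common⊆S x∈Q x∈Q′) Q′-avoids-N Q-avoids-N Q′≤Q

theorem2 : (n : ℕ) (D : Digraph n) (S N V₁ V₂ : Subset n) →
    IsSourceSet D S → IsOutNbhdOf D S N →
    IsPartitionOfRest S N V₁ V₂ →
    KernelPerfectOn D V₁ → KernelPerfectOn D V₂ →
    Σ (Subset n) λ Q → IsQuasiKernel D Q × 2 * ∣ Q ∣ + ∣ N ∣ ≤ n + ∣ S ∣
theorem2 n D S N V₁ V₂ srcS outN part kp₁ kp₂ =
  small-quasiKernel D srcS outN (▷-partition D part) P′⊆N⁺P (proj₂ kernel) (proj₂ kernel′)
  where
  P P′ : Subset n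
  P = _▷_ D V₁ V₂
  P′ = V₂ ∩ N⁺ D V₁

  P-kp : KernelPerfectOn D P
  P-kp = ▷-kernelPerfect D V₁ V₂ kp₁ kp₂

  P′-kp : KernelPerfectOn D P′
  P′-kp = KernelPerfectOn-⊆ D (p∩q⊆p V₂ _) kp₂

  P′⊆N⁺P : P′ ⊆ N⁺ D P
  P′⊆N⁺P v∈P′ with ∈N⁺⁻ D V₁ (p∩q⊆q V₂ _ v∈P′)
  ... | u , u∈V₁ , u→v = ∈N⁺⁺ D P (u , p⊆p∪q _ u∈V₁ , u→v)

  kernel : Σ (Subset n) (IsKernelOfInduced D (_▷_ D P′ P))
  kernel = ▷-kernelPerfect D P′ P P′-kp P-kp (_▷_ D P′ P) (λ x∈ → x∈)

  W : Subset n
  W = P ─ proj₁ kernel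

  kernel′ : Σ (Subset n) (IsKernelOfInduced D (_▷_ D W P′))
  -- As a subset of `P`, the set `W` is kernel-perfect whichever kernel was chosen first.
  kernel′ = ▷-kernelPerfect D W P′ (KernelPerfectOn-⊆ D (p─q⊆p P _) P-kp) P′-kp (_▷_ D W P′) (λ x∈ → x∈)
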